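{- Let $G$ be a graph with vertex set $V$, and let $\mathcal{G}$ be the family of minimal generating sets of $G$. If $\mathcal{G}=\{L\}$ for a single set $L\subseteq V$, then $\operatorname{nim}(\mathrm{DNT}(G))=\operatorname{pty}(L^c)$, where $L^c=V\setminus L$.
   Context: Graphs are finite and simple with nonempty vertex set. A set $K\subseteq V$ of vertices is convex if it contains every vertex lying on any shortest path between two elements of $K$. The convex hull $[P]$ of $P\subseteq V$ is the smallest convex set containing $P$. A set $P\subseteq V$ is generating if $[P]=V$; a minimal generating set is a generating set that is minimal under inclusion. For a finite set $A$, $\operatorname{pty}(A):=|A| \bmod 2\in\{0,1\}$. The game $\mathrm{DNT}(G)$ (do not terminate): the positions are the sets $P\subseteq V$ (of jointly selected vertices) with $[V\setminus P]=V$; the starting position is $\emptyset$; the options of $P$ are the sets $P\cup\{v\}$ with $v\in V\setminus P$ and $[V\setminus(P\cup\{v\})]=V$. The nim-value of a position is defined recursively by $\operatorname{nim}(p)=\operatorname{mex}\{\operatorname{nim}(q): q\text{ an option of }p\}$, where $\operatorname{mex}(A)$ is the smallest nonnegative integer not in $A$; the nim-value of a game is that of its starting position. -}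

module Defs where

open import Data.Bool.Properties using () renaming (_≟_ to _≟ᵇ_)
open import Data.Fin.Base using (Fin; toℕ; fromℕ<)
import Data.Fin.Properties as Fin
open import Data.Fin.Subset using (Subset; ⊥; ⊤; ⁅_⁆; _∈_; _∉_; _⊆_; _⊂_; _⊃_; _∪_; ∁; ∣_∣)
import Data.Fin.Subset.Properties as Subset
open import Data.Fin.Subset.Induction using (⊃-wellFounded)
open import Data.List.Base using (List; []; _∷_; length; head; last; map; mapMaybe; allFin; lookup)
import Data.List.Membership.Propositional as List
import Data.List.Membership.Propositional.Properties as List
import Data.List.Membership.DecPropositional as DecList
open import Data.List.Relation.Unary.All using (All; all?)
import Data.List.Relation.Unary.All as All
import Data.List.Relation.Unary.Any as Any
import Data.List.Relation.Unary.Any.Properties as Any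
open import Data.List.Relation.Unary.AllPairs using ([]; _∷_)
open import Data.List.Relation.Unary.Linked using (Linked; linked?)
open import Data.List.Relation.Unary.Unique.Propositional using (Unique)
import Data.List.Relation.Unary.Unique.DecPropositional as DecUnique
open import Data.Maybe.Base using (Maybe; just; nothing)
import Data.Maybe.Base as Maybe
import Data.Maybe.Properties as Maybe
open import Data.Nat.Base using (ℕ; zero; suc; _≤_; _<_; z≤n; s≤s; _%_)
import Data.Nat.Properties as ℕ
open import Data.Product.Base using (Σ; ∃; _×_; _,_; proj₁; proj₂; uncurry)
open import Data.Vec.Base using (tabulate)
open import Data.Vec.Properties using (≡-dec; []=⇒lookup; lookup⇒[]=; lookup∘tabulate)
open import Function.Base using (_∘_)
open import Function.Bundles using (_⇔_; mk⇔; Equivalence)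
open import Induction.WellFounded using (WellFounded; Acc; acc; module Subrelation)
open import Level using (0ℓ)
open import Relation.Binary.Core using (Rel)
open import Relation.Binary.Definitions using (Symmetric; Irreflexive) renaming (Decidable to Decidable₂)
open import Relation.Binary.PropositionalEquality
import Relation.Binary.Construct.On as On
open import Relation.Nullary.Decidable using (Dec; yes; no; does; map′; ¬?; _×-dec_; _→-dec_; decidable-stable; dec⇒maybe; dec-true)
open import Relation.Nullary.Negation using (¬_; contradiction)
open import Relation.Unary using (Pred; Decidable)

private
  variable
    n : ℕ

  length-unique : {xs : List (Fin n)} → Unique xs → length xs ≤ n
  length-unique {xs = xs} u = ℕ.≮⇒≥ λ n<len →
    let i , j , i<j , eq = Fin.pigeonhole n<len (lookup xs)
    in lookup-injective u i<j eq
    where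
    lookup-injective : {ys : List (Fin n)} → Unique ys → ∀ {i j} →
                       toℕ i < toℕ j → lookup ys i ≢ lookup ys j
    lookup-injective (x≢ ∷ _) {Fin.zero}  {Fin.suc j} _         = All.lookup x≢ (List.∈-lookup j)
    lookup-injective (_ ∷ u)  {Fin.suc i} {Fin.suc j} (s≤s i<j) = lookup-injective u i<j

  allLists? : ∀ k {P : Pred (List (Fin n)) 0ℓ} → Decidable P →
              Dec (∀ xs → length xs ≤ k → P xs)
  allLists? zero P? = map′ (λ { p [] _ → p }) (λ f → f [] z≤n) (P? [])
  allLists? (suc k) P? = map′
    (λ { (p , _) [] _ → p ; (_ , f) (x ∷ xs) (s≤s le) → f x xs le })
    (λ f → f [] z≤n , λ x xs le → f (x ∷ xs) (s≤s le))
    (P? [] ×-dec Fin.all? λ x → allLists? k (P? ∘ (x ∷_)))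

------------------------------------------------------------------------
-- Graphs and convexity

record Graph (n : ℕ) : Set₁ where
  field
    Adj        : Rel (Fin n) 0ℓ
    adj?       : Decidable₂ Adj
    Adj-sym    : Symmetric Adj
    Adj-irrefl : Irreflexive _≡_ Adj

module _ (G : Graph n) where
  open Graph G

  -- A path is given by its list of vertices; it has one edge fewer than
  -- vertices, so comparing list lengths is comparing path lengths.
  Path : Fin n → Fin n → Pred (List (Fin n)) 0ℓ
  Path u v p = head p ≡ just u × last p ≡ just v × Linked Adj p × Unique p

  ShortestPath : Fin n → Fin n → Pred (List (Fin n)) 0ℓ
  ShortestPath u v p = Path u v p × (∀ q → Path u v q → length p ≤ length q)

  Convex : Pred (Subset n) 0ℓ
  Convex K = ∀ u v → u ∈ K → v ∈ K → ∀ p → ShortestPath u v p → All (_∈ K) p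

  IsConvexHull : Subset n → Subset n → Set
  IsConvexHull P H = Convex H × P ⊆ H × (∀ {K} → Convex K → P ⊆ K → H ⊆ K)

  private
    path? : ∀ u v → Decidable (Path u v)
    path? u v p =
      Maybe.≡-dec Fin._≟_ (head p) (just u) ×-dec
      Maybe.≡-dec Fin._≟_ (last p) (just v) ×-dec
      linked? adj? p ×-dec DecUnique.unique? Fin._≟_ p

    allPaths? : ∀ u v {Q : Pred (List (Fin n)) 0ℓ} → Decidable Q →
                Dec (∀ p → Path u v p → Q p)
    allPaths? u v Q? = map′
      (λ f p path → f p (length-unique (proj₂ (proj₂ (proj₂ path)))) path)
      (λ f p _ → f p)
      (allLists? n λ p → path? u v p →-dec Q? p)

  -- The decision procedures are opaque: unfolding them during type
  -- checking is prohibitively slow, and only their types matter.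
  opaque
    convex? : Decidable Convex
    convex? K = Fin.all? λ u → Fin.all? λ v → u Subset.∈? K →-dec v Subset.∈? K →-dec
      map′ (λ f p → uncurry (f p)) (λ f p path shortest → f p (path , shortest))
        (allPaths? u v λ p →
          allPaths? u v (λ q → length p ℕ.≤? length q) →-dec all? (Subset._∈? K) p)

  private
    opaque
      separated? : ∀ P x → Dec (∃ λ K → Convex K × P ⊆ K × x ∉ K)
      separated? P x = Subset.anySubset? λ K →
        convex? K ×-dec P Subset.⊆? K ×-dec ¬? (x Subset.∈? K)

  -- The convex hull [ P ], realised as the intersection of the convex
  -- sets containing P (x is left out iff some such set separates it from P);
  -- hull-isConvexHull shows that it is the smallest one.
  hull : Subset n → Subset n
  hull P = tabulate λ x → does (¬? (separated? P x))

  hull-isConvexHull : ∀ P → IsConvexHull P (hull P)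
  hull-isConvexHull P = convex , extensive , least
    where
    intro : ∀ {x} → (∀ {K} → Convex K → P ⊆ K → x ∈ K) → x ∈ hull P
    intro {x} f = lookup⇒[]= x _ (trans (lookup∘tabulate _ x)
      (dec-true (¬? (separated? P x)) λ (_ , c , P⊆K , x∉K) → x∉K (f c P⊆K)))

    least : ∀ {K} → Convex K → P ⊆ K → hull P ⊆ K
    least {K} c P⊆K {x} x∈H
      with separated? P x | trans (sym (lookup∘tabulate _ x)) ([]=⇒lookup x∈H)
    ... | no ¬s | _ = decidable-stable (x Subset.∈? K) λ x∉K → ¬s (K , c , P⊆K , x∉K)

    extensive : P ⊆ hull P
    extensive x∈P = intro λ _ P⊆K → P⊆K x∈P

    convex : Convex (hull P)
    convex u v u∈H v∈H p sp = All.tabulate λ x∈p → intro λ c P⊆K →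
      All.lookup (c u v (least c P⊆K u∈H) (least c P⊆K v∈H) p sp) x∈p

  Generating : Pred (Subset n) 0ℓ
  Generating P = hull P ≡ ⊤

  opaque
    generating? : Decidable Generating
    generating? P = ≡-dec _≟ᵇ_ (hull P) ⊤

  MinimalGenerating : Pred (Subset n) 0ℓ
  MinimalGenerating P = Generating P × (∀ {Q} → Q ⊂ P → ¬ Generating Q)

------------------------------------------------------------------------
-- Impartial games and nim-values

IsMex : List ℕ → ℕ → Set
IsMex A m = m List.∉ A × (∀ {k} → k < m → k List.∈ A)

private
  open DecList ℕ._≟_ using (_∈?_)

  ∃mex : ∀ A → ∃ (IsMex A)
  ∃mex A = toℕ i , i∉A , below
    where
    not-all : ¬ (∀ (i : Fin (suc (length A))) → toℕ i List.∈ A)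
    not-all all =
      let i , j , i<j , eq = Fin.pigeonhole ℕ.≤-refl (Any.index ∘ all)
      in ℕ.<⇒≢ i<j (begin
           toℕ i                         ≡⟨ Any.lookup-index (all i) ⟩
           lookup A (Any.index (all i))  ≡⟨ cong (lookup A) eq ⟩
           lookup A (Any.index (all j))  ≡⟨ Any.lookup-index (all j) ⟨
           toℕ j                         ∎)
      where open ≡-Reasoning
    smallest = Fin.¬∀⟶∃¬-smallest _ (λ i → toℕ i List.∈ A) (λ i → toℕ i ∈? A) not-all
    i   = proj₁ smallest
    i∉A = proj₁ (proj₂ smallest)
    below : ∀ {k} → k < toℕ i → k List.∈ A
    below k<i = subst (List._∈ A)
      (trans (Fin.toℕ-inject (fromℕ< k<i)) (Fin.toℕ-fromℕ< k<i))
      (proj₂ (proj₂ smallest) (fromℕ< k<i))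

mex : List ℕ → ℕ
mex A = proj₁ (∃mex A)

mex-isMex : ∀ A → IsMex A (mex A)
mex-isMex A = proj₂ (∃mex A)

record Game : Set₁ where
  field
    Position    : Set
    start       : Position
    options     : Position → List Position
    wellFounded : WellFounded (λ q p → q List.∈ options p)

module _ (Γ : Game) where
  open Game Γ

  private
    nimAcc : ∀ p → Acc (λ q p → q List.∈ options p) p → ℕ
    nimAcc p (acc rs) = mex (List.mapWith∈ (options p) λ q∈ → nimAcc _ (rs q∈))

  nimAt : Position → ℕ
  nimAt p = nimAcc p (wellFounded p)

  private
    nimAcc-irrelevant : ∀ p a b → nimAcc p a ≡ nimAcc p b
    nimAcc-irrelevant p (acc rs) (acc rs′) = cong mex
      (List.mapWith∈-cong (options p) _ _ λ q∈ → nimAcc-irrelevant _ (rs q∈) (rs′ q∈))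

  nimAt-mex : ∀ p → nimAt p ≡ mex (map nimAt (options p))
  nimAt-mex p with wellFounded p
  ... | acc rs = cong mex (trans
    (List.mapWith∈-cong (options p) _ _ λ q∈ → nimAcc-irrelevant _ (rs q∈) (wellFounded _))
    (List.mapWith∈≗map nimAt (options p)))

  nim : ℕ
  nim = nimAt start

------------------------------------------------------------------------
-- Do not terminate

private
  ≡-irrelevant : {A : Set} {x y : A} (e e′ : x ≡ y) → e ≡ e′
  ≡-irrelevant refl refl = refl

  module _ {A B : Set} (f : A → Maybe B) where
    ∈-mapMaybe⁻ : ∀ xs {y} → y List.∈ mapMaybe f xs → ∃ λ x → f x ≡ just y
    ∈-mapMaybe⁻ (x ∷ xs) y∈ with f x in eq
    ∈-mapMaybe⁻ (x ∷ xs) y∈              | nothing = ∈-mapMaybe⁻ xs y∈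
    ∈-mapMaybe⁻ (x ∷ xs) (Any.here refl) | just _  = x , eq
    ∈-mapMaybe⁻ (x ∷ xs) (Any.there y∈)  | just _  = ∈-mapMaybe⁻ xs y∈

    ∈-mapMaybe⁺ : ∀ {xs x y} → x List.∈ xs → f x ≡ just y → y List.∈ mapMaybe f xs
    ∈-mapMaybe⁺ {x ∷ _} (Any.here refl) eq rewrite eq = Any.here refl
    ∈-mapMaybe⁺ {x ∷ _} (Any.there x∈)  eq with f x
    ... | nothing = ∈-mapMaybe⁺ x∈ eq
    ... | just _  = Any.there (∈-mapMaybe⁺ x∈ eq)

module _ (G : Graph n) where

  DNTPosition : Set
  DNTPosition = Σ (Subset n) λ P → Generating G (∁ P)

  Legal : Subset n → Fin n → Set
  Legal P v = v ∉ P × Generating G (∁ (P ∪ ⁅ v ⁆))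

  private
    legal? : ∀ P v → Dec (Legal P v)
    legal? P v = ¬? (v Subset.∈? P) ×-dec generating? G (∁ (P ∪ ⁅ v ⁆))

    play : ∀ P → Fin n → Maybe DNTPosition
    play P v = Maybe.map (λ legal → P ∪ ⁅ v ⁆ , proj₂ legal) (dec⇒maybe (legal? P v))

  DNTOptions : DNTPosition → List DNTPosition
  DNTOptions (P , _) = mapMaybe (play P) (allFin n)

  -- The condition that the new set is again a position is part of q.
  ∈-DNTOptions : ∀ p q → q List.∈ DNTOptions p ⇔
                 ∃ λ v → v ∉ proj₁ p × proj₁ q ≡ proj₁ p ∪ ⁅ v ⁆
  ∈-DNTOptions (P , g₀) (Q , g) = mk⇔ to from
    where
    to : (Q , g) List.∈ DNTOptions (P , g₀) → ∃ λ v → v ∉ P × Q ≡ P ∪ ⁅ v ⁆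
    to q∈ with ∈-mapMaybe⁻ (play P) (allFin n) q∈
    ... | v , eq with legal? P v
    to q∈ | v , refl | yes (v∉P , _) = v , v∉P , refl

    from : (∃ λ v → v ∉ P × Q ≡ P ∪ ⁅ v ⁆) → (Q , g) List.∈ DNTOptions (P , g₀)
    from (v , v∉P , refl) = ∈-mapMaybe⁺ (play P) (List.∈-allFin v) eq
      where
      eq : play P v ≡ just (P ∪ ⁅ v ⁆ , g)
      eq with legal? P v
      ... | yes (_ , g′) = cong (λ h → just (P ∪ ⁅ v ⁆ , h)) (≡-irrelevant g′ g)
      ... | no ¬legal = contradiction (v∉P , g) ¬legal

  DNT : Game
  DNT = record
    { Position    = DNTPosition
    ; start       = ⊥ , start-generating
    ; options     = DNTOptions
    ; wellFounded = Subrelation.wellFounded (λ {q} {p} → option-⊃ {q} {p})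
        (On.wellFounded proj₁ ⊃-wellFounded)
    }
    where
    start-generating : Generating G (∁ ⊥)
    start-generating = Subset.⊆-antisym (λ _ → Subset.∈⊤)
      λ x∈⊤ → proj₁ (proj₂ (hull-isConvexHull G (∁ ⊥))) (Subset.x∉p⇒x∈∁p Subset.∉⊥)

    option-⊃ : ∀ {q p} → q List.∈ DNTOptions p → proj₁ q ⊃ proj₁ p
    option-⊃ {q} {p} q∈ with Equivalence.to (∈-DNTOptions p q) q∈
    ... | v , v∉P , refl =
      Subset.p⊆p∪q ⁅ v ⁆ , v , Subset.q⊆p∪q (proj₁ p) ⁅ v ⁆ (Subset.x∈⁅x⁆ v) , v∉P

pty : Subset n → ℕ
pty A = ∣ A ∣ % 2

{-# OPTIONS --safe #-}

-- The generating sets are exactly the supersets of L, so a set P is a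
-- position iff it avoids L. Hence every play from P takes exactly
-- |L^c| - |P| moves, and the nim-value of P is the parity of that number.

module Submission where

open import Defs
open import Data.Nat.Base using (ℕ; NonZero)
open import Data.Fin.Subset using (Subset; ∁)
open import Relation.Binary.PropositionalEquality using (_≡_)
open import Relation.Unary using (_≐_; ｛_｝)

open import Data.Bool.Base using (true; false)
open import Data.Fin.Base using (zero; suc)
import Data.Fin.Properties as Fin
open import Data.Fin.Subset using (⁅_⁆; _∈_; _∉_; _⊆_; _⊂_; _∪_; ∣_∣)
import Data.Fin.Subset.Properties as Subset
open import Data.Fin.Subset.Induction using (⊂-wellFounded)
open import Data.List.Base using (map)
import Data.List.Membership.Propositional as List
import Data.List.Membership.Propositional.Properties as List
open import Data.Nat.Base using (zero; suc; _∸_; _<_; _%_; z<s)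
import Data.Nat.Properties as ℕ
open import Data.Product.Base using (∃; _×_; _,_; proj₁; proj₂)
open import Data.Sum.Base using ([_,_])
open import Data.Vec.Base using (_∷_; here; there)
open import Function.Base using (_∘_)
open import Function.Bundles using (Equivalence)
open import Induction.WellFounded using (Acc; acc)
open import Relation.Binary.Definitions using (tri<; tri≈; tri>)
open import Relation.Binary.PropositionalEquality
  using (refl; sym; trans; cong; subst; module ≡-Reasoning)
open import Relation.Nullary.Decidable using (yes; no; ¬?; _×-dec_; decidable-stable)
open import Relation.Nullary.Negation using (contradiction)

private
  variable
    n : ℕ

x∉p⇒∣p∪⁅x⁆∣≡1+∣p∣ : ∀ {x} (p : Subset n) → x ∉ p → ∣ p ∪ ⁅ x ⁆ ∣ ≡ suc ∣ p ∣
x∉p⇒∣p∪⁅x⁆∣≡1+∣p∣ {x = zero}  (true  ∷ p) x∉p = contradiction here x∉p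
x∉p⇒∣p∪⁅x⁆∣≡1+∣p∣ {x = zero}  (false ∷ p) x∉p = cong (suc ∘ ∣_∣) (Subset.∪-identityʳ p)
x∉p⇒∣p∪⁅x⁆∣≡1+∣p∣ {x = suc x} (true  ∷ p) x∉p =
  cong suc (x∉p⇒∣p∪⁅x⁆∣≡1+∣p∣ p (x∉p ∘ there))
x∉p⇒∣p∪⁅x⁆∣≡1+∣p∣ {x = suc x} (false ∷ p) x∉p = x∉p⇒∣p∪⁅x⁆∣≡1+∣p∣ p (x∉p ∘ there)

∣p∣<∣q∣⇒∃x∈q∖p : (p q : Subset n) → ∣ p ∣ < ∣ q ∣ → ∃ λ x → x ∈ q × x ∉ p
∣p∣<∣q∣⇒∃x∈q∖p p q ∣p∣<∣q∣ with Fin.any? (λ x → (x Subset.∈? q) ×-dec ¬? (x Subset.∈? p))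
... | yes found = found
... | no  none  = contradiction (Subset.p⊆q⇒∣p∣≤∣q∣ q⊆p) (ℕ.<⇒≱ ∣p∣<∣q∣)
  where
  q⊆p : q ⊆ p
  q⊆p {x} x∈q = decidable-stable (x Subset.∈? p) λ x∉p → none (x , x∈q , x∉p)

p⊆∁q⇒q⊆∁p : (p q : Subset n) → p ⊆ ∁ q → q ⊆ ∁ p
p⊆∁q⇒q⊆∁p p q p⊆∁q x∈q = Subset.x∉p⇒x∈∁p λ x∈p → Subset.x∈∁p⇒x∉p (p⊆∁q x∈p) x∈q

p∪⁅x⁆⊆q : ∀ {p q : Subset n} {x} → p ⊆ q → x ∈ q → p ∪ ⁅ x ⁆ ⊆ q
p∪⁅x⁆⊆q {p = p} {q} {x} p⊆q x∈q =
  [ p⊆q , (λ y∈⁅x⁆ → subst (_∈ q) (sym (Subset.x∈⁅y⁆⇒x≡y x y∈⁅x⁆)) x∈q) ] ∘ Subset.x∈p∪q⁻ p ⁅ x ⁆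

mex-unique : ∀ {A m} → IsMex A m → mex A ≡ m
mex-unique {A} {m} (m∉A , below) with mex-isMex A | ℕ.<-cmp (mex A) m
... | mex∉A , _      | tri< mex<m _ _ = contradiction (below mex<m) mex∉A
... | _              | tri≈ _ mex≡m _ = mex≡m
... | _     , below′ | tri> _ _ m<mex = contradiction (below′ m<mex) m∉A

mex-empty : ∀ {A} → (∀ {a} → a List.∉ A) → mex A ≡ 0
mex-empty empty = mex-unique (empty , λ ())

-- As a set, `A` is {0} or {1}, whose mex is 1 or 0. The member `a` rules out the empty list, whose
-- mex would be 0 in both cases.
mex-parity : ∀ k {A a} → (∀ {b} → b List.∈ A → b ≡ k % 2) → a List.∈ A → mex A ≡ suc k % 2
mex-parity zero {A} const a∈A = mex-unique ((λ 1∈A → contradiction (const 1∈A) λ ()) ,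
  λ { z<s → subst (List._∈ A) (const a∈A) a∈A })
mex-parity (suc zero)    const a∈A =
  mex-unique ((λ 0∈A → contradiction (const 0∈A) λ ()) , λ ())
-- `suc (suc k) % 2` reduces to `k % 2`, so the claim is literally the one for `k`.
mex-parity (suc (suc k)) const a∈A = mex-parity k const a∈A

module _ (Γ : Game) (rank : Game.Position Γ → ℕ)
  (rank-option : ∀ p q → q List.∈ Game.options Γ p → rank p ≡ suc (rank q))
  (∃option : ∀ p → 0 < rank p → ∃ (List._∈ Game.options Γ p))
  where

  -- The module hypotheses make every play from `p` last exactly `rank p` moves. By induction all
  -- options of `p` share one nim-value, so the mex is taken over a singleton, or over nothing at
  -- rank 0.
  nimAt-parity : ∀ k p → rank p ≡ k → nimAt Γ p ≡ k % 2
  nimAt-parity zero p rank≡0 = trans (nimAt-mex Γ p) (mex-empty λ a∈ →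
    let q , q∈ , _ = List.∈-map⁻ (nimAt Γ) a∈
    in ℕ.0≢1+n (trans (sym rank≡0) (rank-option p q q∈)))
  nimAt-parity (suc k) p rank≡1+k = trans (nimAt-mex Γ p)
    (mex-parity k options-parity (List.∈-map⁺ (nimAt Γ) (proj₂ option)))
    where
    option = ∃option p (subst (0 <_) (sym rank≡1+k) z<s)

    options-parity : ∀ {a} → a List.∈ map (nimAt Γ) (Game.options Γ p) → a ≡ k % 2
    options-parity a∈ with List.∈-map⁻ (nimAt Γ) a∈
    ... | q , q∈ , refl =
      nimAt-parity k q (ℕ.suc-injective (trans (sym (rank-option p q q∈)) rank≡1+k))

module _ (G : Graph n) where

  -- The hull of `Q` is a convex set containing `P`, so it contains the hull of `P`.
  Generating-⊆ : ∀ {P Q} → P ⊆ Q → Generating G P → Generating G Q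
  Generating-⊆ {P} {Q} P⊆Q hullP≡⊤ =
    let convex , Q⊆hullQ , _ = hull-isConvexHull G Q
        _ , _ , least        = hull-isConvexHull G P
    in Subset.⊆-antisym Subset.⊆⊤
         (subst (_⊆ hull G Q) hullP≡⊤ (least convex (Q⊆hullQ ∘ P⊆Q)))

  -- Pass to a strictly smaller generating subset as long as there is one; strict inclusion of
  -- finite sets is well-founded.
  ∃minimalGenerating : ∀ P → Generating G P → ∃ λ M → MinimalGenerating G M × M ⊆ P
  ∃minimalGenerating P = go P (⊂-wellFounded P)
    where
    go : ∀ P → Acc _⊂_ P → Generating G P → ∃ λ M → MinimalGenerating G M × M ⊆ P
    go P (acc rs) gen
      with Subset.anySubset? (λ Q → (Q Subset.⊂? P) ×-dec generating? G Q)
    ... | no minimal = P , (gen , λ Q⊂P genQ → minimal (_ , Q⊂P , genQ)) , Subset.⊆-refl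
    ... | yes (Q , Q⊂P , genQ) =
      let M , minM , M⊆Q = go Q (rs Q⊂P) genQ
      in M , minM , proj₁ Q⊂P ∘ M⊆Q

  module UniqueMinimalGenerating {L : Subset n} (unique : MinimalGenerating G ≐ ｛ L ｝) where

    -- The minimal generating set found inside `P` can only be `L`.
    Generating⇒L⊆ : ∀ {P} → Generating G P → L ⊆ P
    Generating⇒L⊆ {P} gen =
      let M , minM , M⊆P = ∃minimalGenerating P gen
      in subst (_⊆ P) (sym (proj₁ unique minM)) M⊆P

    L⊆⇒Generating : ∀ {P} → L ⊆ P → Generating G P
    L⊆⇒Generating L⊆P = Generating-⊆ L⊆P (proj₁ (proj₂ unique refl))

    position⊆∁L : (p : DNTPosition G) → proj₁ p ⊆ ∁ L
    position⊆∁L (P , gen) = p⊆∁q⇒q⊆∁p L P (Generating⇒L⊆ gen)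

    -- The rank for `nimAt-parity`. Truncation in `∸` loses nothing, since `position⊆∁L` bounds the
    -- size of `P` by that of `∁ L`.
    movesLeft : DNTPosition G → ℕ
    movesLeft (P , _) = ∣ ∁ L ∣ ∸ ∣ P ∣

    movesLeft-option : ∀ p q → q List.∈ DNTOptions G p → movesLeft p ≡ suc (movesLeft q)
    movesLeft-option p q q∈ with Equivalence.to (∈-DNTOptions G p q) q∈
    ... | v , v∉P , Q≡P∪⁅v⁆ = begin
      ∣ ∁ L ∣ ∸ ∣ proj₁ p ∣         ≡⟨⟩
      suc ∣ ∁ L ∣ ∸ suc ∣ proj₁ p ∣ ≡⟨ cong (suc ∣ ∁ L ∣ ∸_) ∣Q∣≡1+∣P∣ ⟨
      -- Pulling `suc` out of `∸` needs the subtracted size to be at most that of `∁ L`; this holds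
      -- because `q` is itself a position.
      suc ∣ ∁ L ∣ ∸ ∣ proj₁ q ∣     ≡⟨ ℕ.+-∸-assoc 1 (Subset.p⊆q⇒∣p∣≤∣q∣ (position⊆∁L q)) ⟩
      suc (∣ ∁ L ∣ ∸ ∣ proj₁ q ∣)   ∎
      where
      open ≡-Reasoning
      ∣Q∣≡1+∣P∣ = trans (cong ∣_∣ Q≡P∪⁅v⁆) (x∉p⇒∣p∪⁅x⁆∣≡1+∣p∣ (proj₁ p) v∉P)

    -- By counting, some vertex lies outside both `P` and `L`. Selecting it keeps `L` in the
    -- complement, which therefore still generates.
    ∃option : ∀ p → 0 < movesLeft p → ∃ (List._∈ DNTOptions G p)
    ∃option p@(P , _) 0<movesLeft =
      let v , v∈∁L , v∉P = ∣p∣<∣q∣⇒∃x∈q∖p P (∁ L) (ℕ.≰⇒> λ ∣∁L∣≤∣P∣ →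
            ℕ.<⇒≢ 0<movesLeft (sym (ℕ.m≤n⇒m∸n≡0 ∣∁L∣≤∣P∣)))
          q = P ∪ ⁅ v ⁆ , L⊆⇒Generating
                (p⊆∁q⇒q⊆∁p (P ∪ ⁅ v ⁆) L (p∪⁅x⁆⊆q (position⊆∁L p) v∈∁L))
      in q , Equivalence.from (∈-DNTOptions G p q) (v , v∉P , refl)

proposition4p3 : (n : ℕ) → .{{_ : NonZero n}} → (G : Graph n) → (L : Subset n) →
    MinimalGenerating G ≐ ｛ L ｝ → nim (DNT G) ≡ pty (∁ L)
proposition4p3 n G L unique =
  nimAt-parity (DNT G) movesLeft movesLeft-option ∃option ∣ ∁ L ∣ (Game.start (DNT G))
    -- The game starts at the empty set, so its rank is the full size of `∁ L`.
    (cong (∣ ∁ L ∣ ∸_) (Subset.∣⊥∣≡0 n))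
  where open UniqueMinimalGenerating G unique
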